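{- Let $n>2$ and $t$ be two positive integers. Then \[\varphi(C_n\boxdot K_t)=\begin{cases} t+2, & \text{if } n\leq t+1,\\ n, & \text{if } t+2\leq n\leq 2t+3,\\ 2t+3, & \text{otherwise}. \end{cases}\]
   Context: All graphs are finite and simple. $C_n$ and $K_n$ denote respectively the cycle and the complete graph with $n$ vertices. The subdivision graph $S(G)$ of a graph $G$ is obtained by inserting one new vertex into every edge of $G$. For graphs $G$ and $H$, with $V(G)=\{u_0,\ldots,u_{m-1}\}$, the subdivision-vertex neighbourhood corona (SVN corona) $G\boxdot H$ is the graph obtained from $S(G)$ by adding $m$ vertex-disjoint copies of $H$ (one for each $u_i$) and joining, for each $i$, every vertex of $N_{S(G)}(u_i)$ (the neighbourhood of $u_i$ in $S(G)$) to every vertex of the copy of $H$ associated with $u_i$. A $b$-chromatic coloring of a graph with $k$ colors is a proper coloring with colors $0,\ldots,k-1$ such that, for each color $i$, there is a vertex (a $b$-vertex) of color $i$ having, for each color $j\neq i$, a neighbour of color $j$. The $b$-chromatic number $\varphi(G)$ is the maximum $k$ for which $G$ has a $b$-chromatic coloring with $k$ colors. -}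

module Defs where

open import Data.Empty using (⊥)
open import Data.Fin.Base as Fin using (Fin; zero; suc; toℕ)
open import Data.Fin.Properties as Fin using (+↔⊎; *↔×; inj⇒≟)
open import Data.Irrelevant using ([_])
open import Data.Nat.Base using (ℕ; zero; suc; _+_; _*_; _≤_; _<_; s≤s; z≤n)
open import Data.Nat.Properties as ℕ using (<⇒≢; 1+n≢n)
open import Data.Product.Base using (Σ-syntax; ∃-syntax; _×_; _,_; proj₁; proj₂; -,_)
open import Data.Product.Function.NonDependent.Propositional using (_×-↔_)
open import Data.Refinement using (Refinement-syntax; value; _,_)
open import Data.Refinement.Properties using (value-injective)
open import Data.Sum.Base using (_⊎_; inj₁; inj₂; swap; reduce)
open import Data.Sum.Function.Propositional using (_⊎-↔_)
open import Function.Base using (_∘_)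
open import Function.Bundles using (_↔_; mk↔ₛ′; Inverse)
open import Function.Construct.Composition using (_↔-∘_)
open import Function.Construct.Identity using (↔-id)
open import Function.Construct.Symmetry using (↔-sym)
open import Function.Properties.Inverse using (↔⇒↣)
open import Level using (0ℓ)
open import Relation.Binary.Core using (Rel)
open import Relation.Binary.Definitions
  using (Symmetric; Irreflexive; Decidable; DecidableEquality)
open import Relation.Binary.PropositionalEquality
  using (_≡_; _≢_; refl; sym; trans; cong; subst)
open import Relation.Nullary using (Dec; yes; no; ¬?; _×-dec_; _⊎-dec_; contradiction-irr)
import Relation.Unary as Unary

Finite : Set → Set
Finite A = ∃[ n ] A ↔ Fin n

private
  transport : {A B : Set} → A ↔ B → Finite B → Finite A
  transport A↔B (n , B↔n) = n , B↔n ↔-∘ A↔B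

  ⊎-finite : {A B : Set} → Finite A → Finite B → Finite (A ⊎ B)
  ⊎-finite (m , A↔m) (n , B↔n) = m + n , ↔-sym +↔⊎ ↔-∘ (A↔m ⊎-↔ B↔n)

  ×-finite : {A B : Set} → Finite A → Finite B → Finite (A × B)
  ×-finite (m , A↔m) (n , B↔n) = m * n , ↔-sym *↔× ↔-∘ (A↔m ×-↔ B↔n)

  refine-yes : ∀ {n} {P : Fin (suc n) → Set} → P zero →
               [ i ∈ Fin (suc n) ∣ P i ] ↔ (Fin 1 ⊎ [ i ∈ Fin n ∣ P (suc i) ])
  refine-yes {n} {P} p = mk↔ₛ′ to from
    (λ { (inj₁ zero) → refl ; (inj₂ (i , q)) → refl })
    (λ { (zero , q) → refl ; (suc i , q) → refl })
    where
    to : [ i ∈ Fin (suc n) ∣ P i ] → Fin 1 ⊎ [ i ∈ Fin n ∣ P (suc i) ]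
    to (zero  , q) = inj₁ zero
    to (suc i , q) = inj₂ (i , q)
    from : Fin 1 ⊎ [ i ∈ Fin n ∣ P (suc i) ] → [ i ∈ Fin (suc n) ∣ P i ]
    from (inj₁ _)       = zero , [ p ]
    from (inj₂ (i , q)) = suc i , q

  refine-no : ∀ {n} {P : Fin (suc n) → Set} → (P zero → ⊥) →
              [ i ∈ Fin (suc n) ∣ P i ] ↔ [ i ∈ Fin n ∣ P (suc i) ]
  refine-no {n} {P} ¬p = mk↔ₛ′ to (λ { (i , q) → suc i , q })
    (λ { (i , q) → refl })
    (λ { (zero , [ q ]) → contradiction-irr q ¬p ; (suc i , q) → refl })
    where
    to : [ i ∈ Fin (suc n) ∣ P i ] → [ i ∈ Fin n ∣ P (suc i) ]
    to (zero  , [ q ]) = contradiction-irr q ¬p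
    to (suc i , q)     = i , q

  refineFin-finite : ∀ n {P : Fin n → Set} → Unary.Decidable P →
                     Finite [ i ∈ Fin n ∣ P i ]
  refineFin-finite zero P? = 0 , mk↔ₛ′ (λ { (() , _) }) (λ ()) (λ ()) (λ { (() , _) })
  refineFin-finite (suc n) P? with P? zero
  ... | yes p = transport (refine-yes p)
                  (⊎-finite (-, ↔-id _) (refineFin-finite n (P? ∘ suc)))
  ... | no ¬p = transport (refine-no ¬p) (refineFin-finite n (P? ∘ suc))

  refine-finite : {A : Set} {P : A → Set} → Finite A → Unary.Decidable P →
                  Finite [ a ∈ A ∣ P a ]
  refine-finite {A} {P} (n , A↔n) P? =
    transport (mk↔ₛ′ to′ from′
                (λ { (i , q) → value-injective (strictlyInverseˡ i) })
                (λ { (a , q) → value-injective (strictlyInverseʳ a) }))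
              (refineFin-finite n (P? ∘ from))
    where
    open Inverse A↔n
    to′ : [ a ∈ A ∣ P a ] → [ i ∈ Fin n ∣ P (from i) ]
    to′ (a , [ q ]) = to a , [ subst P (sym (strictlyInverseʳ a)) q ]
    from′ : [ i ∈ Fin n ∣ P (from i) ] → [ a ∈ A ∣ P a ]
    from′ (i , q) = from i , q

record Graph : Set₁ where
  field
    Vertex : Set
    finite : Finite Vertex
    Adj    : Rel Vertex 0ℓ
    adj?   : Decidable Adj
    symm   : Symmetric Adj
    irrefl : Irreflexive _≡_ Adj

  index : Vertex → Fin (proj₁ finite)
  index = Inverse.to (proj₂ finite)

  _≟ᵥ_ : DecidableEquality Vertex
  _≟ᵥ_ = inj⇒≟ (↔⇒↣ (proj₂ finite))

  -- An edge {u , v} is represented by the pair of its ends, listed in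
  -- the order of the enumeration, so that each edge occurs exactly once.
  Edge : Set
  Edge = [ e ∈ Vertex × Vertex ∣ index (proj₁ e) Fin.< index (proj₂ e) × Adj (proj₁ e) (proj₂ e) ]

  _IsEndOf_ : Vertex → Edge → Set
  u IsEndOf e = u ≡ proj₁ (value e) ⊎ u ≡ proj₂ (value e)

  edge-finite : Finite Edge
  edge-finite = refine-finite (×-finite finite finite)
    λ { (u , v) → (index u Fin.<? index v) ×-dec adj? u v }

open Graph using (Vertex; Adj)

K : ℕ → Graph
K n = record
  { Vertex = Fin n
  ; finite = n , ↔-id _
  ; Adj    = _≢_
  ; adj?   = λ i j → ¬? (i Fin.≟ j)
  ; symm   = λ i≢j → i≢j ∘ sym
  ; irrefl = λ i≡j i≢j → i≢j i≡j
  }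

-- j is i + 1 modulo n.
Next : ∀ {n} → Fin n → Fin n → Set
Next {n} i j = toℕ j ≡ suc (toℕ i) ⊎ (suc (toℕ i) ≡ n × toℕ j ≡ 0)

C : (n : ℕ) → 2 < n → Graph
C n 2<n = record
  { Vertex = Fin n
  ; finite = n , ↔-id _
  ; Adj    = λ i j → Next i j ⊎ Next j i
  ; adj?   = λ i j → next? i j ⊎-dec next? j i
  ; symm   = swap
  ; irrefl = λ { refl → ¬next ∘ reduce }
  }
  where
  next? : Decidable (Next {n})
  next? i j = (toℕ j ℕ.≟ suc (toℕ i))
    ⊎-dec ((suc (toℕ i) ℕ.≟ n) ×-dec (toℕ j ℕ.≟ 0))

  ¬next : ∀ {i} → Next {n} i i → ⊥
  ¬next (inj₁ i≡1+i)         = 1+n≢n (sym i≡1+i)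
  ¬next (inj₂ (1+i≡n , i≡0)) =
    <⇒≢ (ℕ.<-trans (s≤s (s≤s z≤n)) 2<n) (trans (cong suc (sym i≡0)) 1+i≡n)

S : Graph → Graph
S G = record
  { Vertex = V
  ; finite = ⊎-finite G.finite G.edge-finite
  ; Adj    = _~_
  ; adj?   = adj?
  ; symm   = λ {x} {y} → symm x y
  ; irrefl = λ { {x} refl → irrefl x }
  }
  where
  module G = Graph G

  V : Set
  V = G.Vertex ⊎ G.Edge

  _~_ : Rel V 0ℓ
  inj₁ u ~ inj₁ v = ⊥
  inj₁ u ~ inj₂ e = u G.IsEndOf e
  inj₂ e ~ inj₁ u = u G.IsEndOf e
  inj₂ e ~ inj₂ f = ⊥

  end? : ∀ u e → Dec (u G.IsEndOf e)
  end? u e = (u G.≟ᵥ _) ⊎-dec (u G.≟ᵥ _)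

  adj? : Decidable _~_
  adj? (inj₁ u) (inj₁ v) = no λ ()
  adj? (inj₁ u) (inj₂ e) = end? u e
  adj? (inj₂ e) (inj₁ u) = end? u e
  adj? (inj₂ e) (inj₂ f) = no λ ()

  symm : ∀ x y → x ~ y → y ~ x
  symm (inj₁ u) (inj₂ e) p = p
  symm (inj₂ e) (inj₁ u) p = p

  irrefl : ∀ x → x ~ x → ⊥
  irrefl (inj₁ u) ()
  irrefl (inj₂ e) ()

infixl 6 _⊡_

-- inj₂ (u , h) is the vertex h in the copy of H associated with u.
_⊡_ : Graph → Graph → Graph
G ⊡ H = record
  { Vertex = V
  ; finite = ⊎-finite SG.finite (×-finite G.finite H.finite)
  ; Adj    = _~_
  ; adj?   = adj?
  ; symm   = λ {x} {y} → symm x y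
  ; irrefl = λ { {x} refl → irrefl x }
  }
  where
  module G  = Graph G
  module H  = Graph H
  module SG = Graph (S G)

  V : Set
  V = SG.Vertex ⊎ (G.Vertex × H.Vertex)

  _~_ : Rel V 0ℓ
  inj₁ x       ~ inj₁ y       = SG.Adj x y
  inj₁ x       ~ inj₂ (u , h) = SG.Adj (inj₁ u) x
  inj₂ (u , h) ~ inj₁ x       = SG.Adj (inj₁ u) x
  inj₂ (u , h) ~ inj₂ (v , k) = u ≡ v × H.Adj h k

  adj? : Decidable _~_
  adj? (inj₁ x)       (inj₁ y)       = SG.adj? x y
  adj? (inj₁ x)       (inj₂ (u , h)) = SG.adj? (inj₁ u) x
  adj? (inj₂ (u , h)) (inj₁ x)       = SG.adj? (inj₁ u) x
  adj? (inj₂ (u , h)) (inj₂ (v , k)) = (u G.≟ᵥ v) ×-dec H.adj? h k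

  symm : ∀ x y → x ~ y → y ~ x
  symm (inj₁ x) (inj₁ y) p         = SG.symm {x} {y} p
  symm (inj₁ x) (inj₂ _) p         = p
  symm (inj₂ _) (inj₁ x) p         = p
  symm (inj₂ _) (inj₂ _) (u≡v , p) = sym u≡v , H.symm p

  irrefl : ∀ x → x ~ x → ⊥
  irrefl (inj₁ x)       p       = SG.irrefl {x} refl p
  irrefl (inj₂ (u , h)) (_ , p) = H.irrefl refl p

module _ (G : Graph) where

  Proper : ∀ {k} → (Vertex G → Fin k) → Set
  Proper c = ∀ u v → Adj G u v → c u ≢ c v

  IsBVertex : ∀ {k} → (Vertex G → Fin k) → Vertex G → Set
  IsBVertex c v = ∀ j → j ≢ c v → ∃[ w ] Adj G v w × c w ≡ j

  IsBColouring : ∀ {k} → (Vertex G → Fin k) → Set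
  IsBColouring c = Proper c × (∀ i → ∃[ v ] c v ≡ i × IsBVertex c v)

  BColourable : ℕ → Set
  BColourable k = Σ[ c ∈ (Vertex G → Fin k) ] IsBColouring c

-- φ G ≐ k says that the maximum defining φ(G) exists and equals k.
infix 4 φ_≐_

φ_≐_ : Graph → ℕ → Set
φ G ≐ k = BColourable G k × (∀ m → BColourable G m → m ≤ k)

{-# OPTIONS --safe #-}
-- A b-vertex of an m-colouring has at least m colours in its closed
-- neighbourhood, which has 3 elements for u_i, t + 2 for a vertex of a copy of
-- K_t, and 2t + 3 for an edge vertex e_i = u_i u_{i+1}.  So if m > t + 2, all
-- b-vertices are edge vertices, whence m ≤ n and m ≤ 2t + 3.
--
-- For n ≤ t + 2, colour e_i with i and the copy of K_t at u_i with the t colours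
-- other than those of e_{i-1} and e_i; all vertices of the copies are b-vertices,
-- and since n ≥ 3 every colour is missing from some pair {e_{i-1}, e_i}.
--
-- For k = t + 3 + d ≤ n with d ≤ t, colour e_i with i if i < k and with 0
-- otherwise, and colour the block formed by u_i and its copy with the colours
-- c(e_i) + 1 + h + min(h, d) modulo k, 0 ≤ h ≤ t.  A block avoids the colours of
-- the two adjacent edge vertices, and for i < k the blocks at u_i and u_{i+1}
-- show all colours but i, so that e_i is a b-vertex.
module Submission where

open import Defs
open import Data.Bool.Base using (if_then_else_; _∧_; true; false)
open import Data.Nat.Base using (ℕ; _+_; _*_; _<_; _≤ᵇ_)
open import Data.Nat.Base
  using (zero; suc; _≤_; _∸_; _⊓_; s≤s; z≤n; s≤s⁻¹; z<s; s<s; NonZero)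
import Data.Nat.Properties as ℕ
open import Algebra.Properties.CommutativeSemigroup ℕ.+-commutativeSemigroup using (x∙yz≈y∙xz)
open import Data.Nat.DivMod
  using (_%_; _mod_; m%n<n; %-distribˡ-+; [m+n]%n≡m%n; m<n⇒m%n≡m; n%n≡0; m%n%n≡m%n)
open import Data.Fin.Base as Fin
  using (Fin; zero; suc; toℕ; fromℕ; fromℕ<; inject₁; inject≤; punchIn; punchOut)
import Data.Fin.Properties as Fin
open import Data.List.Base using (List; []; _∷_; _++_; length; lookup; map; allFin)
open import Data.List.Properties using (length-++; length-map; length-tabulate)
open import Data.List.Membership.Propositional using (_∈_)
open import Data.List.Membership.Propositional.Properties
  using (∈-map⁺; ∈-++⁺ˡ; ∈-++⁺ʳ; ∈-allFin)
open import Data.List.Relation.Unary.Any as Any using (here; there)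
open import Data.List.Relation.Unary.Any.Properties using (lookup-index)
open import Data.Irrelevant using ([_])
open import Data.Product.Base using (∃-syntax; _×_; _,_; proj₁; proj₂)
open import Data.Refinement using (value; _,_)
open import Data.Sum.Base using (_⊎_; inj₁; inj₂; [_,_]′; swap)
open import Function.Base using (_∘_)
open import Relation.Binary.Definitions using (tri<; tri≈; tri>)
open import Relation.Binary.PropositionalEquality
  using (_≡_; _≢_; refl; sym; trans; cong; cong₂; subst; ≢-sym; module ≡-Reasoning)
open import Relation.Nullary using (¬_; yes; no; contradiction)
open import Relation.Nullary.Decidable using (recompute)
open import Relation.Nullary.Reflects using (ofʸ; ofⁿ)

open Graph using (Vertex; Adj; Edge)

-- Counting the colours around a b-vertex

-- Each colour picks a position in `xs` that carries it, and the colouring inverts this choice. Only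
-- a list covering the closed neighbourhood is asked for, so repetitions are harmless.
bVertex⇒≤ : ∀ (G : Graph) {m} {c : Vertex G → Fin m} {v} (xs : List (Vertex G)) →
            v ∈ xs → (∀ w → Adj G v w → w ∈ xs) → IsBVertex G c v → m ≤ length xs
bVertex⇒≤ G {m} {c} {v} xs v∈xs N⊆xs b = Fin.injective⇒≤ {f = f} λ {i} {j} eq →
  trans (sym (colour-f i)) (trans (cong (c ∘ lookup xs) eq) (colour-f j))
  where
  representative : ∀ j → ∃[ w ] w ∈ xs × c w ≡ j
  representative j with j Fin.≟ c v
  ... | yes j≡cv = v , v∈xs , sym j≡cv
  ... | no j≢cv with w , v~w , cw≡j ← b j j≢cv = w , N⊆xs w v~w , cw≡j

  f : Fin m → Fin (length xs)
  f j = Any.index (proj₁ (proj₂ (representative j)))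

  colour-f : ∀ j → c (lookup xs (f j)) ≡ j
  colour-f j with w , w∈xs , cw≡j ← representative j =
    trans (cong c (sym (lookup-index w∈xs))) cw≡j

-- Colours other than two given ones

-- The inner `punchIn` skips the place of `y` among the elements other than `x`; the outer one skips
-- `x`.
except : ∀ {k} {x y : Fin (2 + k)} → x ≢ y → Fin k → Fin (2 + k)
except {x = x} x≢y h = punchIn x (punchIn (punchOut x≢y) h)

except-injective : ∀ {k} {x y : Fin (2 + k)} (x≢y : x ≢ y) {h h′} →
                   except x≢y h ≡ except x≢y h′ → h ≡ h′
except-injective x≢y eq = Fin.punchIn-injective _ _ _ (Fin.punchIn-injective _ _ _ eq)

except≢ˡ : ∀ {k} {x y : Fin (2 + k)} (x≢y : x ≢ y) h → except x≢y h ≢ x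
except≢ˡ x≢y h = Fin.punchInᵢ≢i _ _

except≢ʳ : ∀ {k} {x y : Fin (2 + k)} (x≢y : x ≢ y) h → except x≢y h ≢ y
except≢ʳ x≢y h eq = Fin.punchInᵢ≢i (punchOut x≢y) h
  (Fin.punchIn-injective _ _ _ (trans eq (sym (Fin.punchIn-punchOut x≢y))))

except-surjective : ∀ {k} {x y : Fin (2 + k)} (x≢y : x ≢ y) {z} →
                    z ≢ x → z ≢ y → ∃[ h ] except x≢y h ≡ z
except-surjective {x = x} x≢y z≢x z≢y =
  punchOut y′≢z′ ,
  trans (cong (punchIn x) (Fin.punchIn-punchOut y′≢z′)) (Fin.punchIn-punchOut (≢-sym z≢x))
  where
  y′≢z′ : punchOut x≢y ≢ punchOut (≢-sym z≢x)
  y′≢z′ = ≢-sym z≢y ∘ Fin.punchOut-injective x≢y (≢-sym z≢x)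

-- Addition modulo the number of colours

module _ {k} .{{_ : NonZero k}} where

  rotate : Fin k → ℕ → Fin k
  rotate i x = (toℕ i + x) mod k

  toℕ-rotate : ∀ i x → toℕ (rotate i x) ≡ (toℕ i + x) % k
  toℕ-rotate i x = Fin.toℕ-fromℕ< (m%n<n (toℕ i + x) k)

  [m+n%k]%k≡[m+n]%k : ∀ m n → (m + n % k) % k ≡ (m + n) % k
  [m+n%k]%k≡[m+n]%k m n = begin
    (m + n % k) % k          ≡⟨ %-distribˡ-+ m (n % k) k ⟩
    (m % k + n % k % k) % k  ≡⟨ cong (λ r → (m % k + r) % k) (m%n%n≡m%n n k) ⟩
    (m % k + n % k) % k      ≡⟨ %-distribˡ-+ m n k ⟨
    (m + n) % k              ∎
    where open ≡-Reasoning

  rotate-0 : ∀ i → rotate i 0 ≡ i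
  rotate-0 i = Fin.toℕ-injective (begin
    toℕ (rotate i 0)  ≡⟨ toℕ-rotate i 0 ⟩
    (toℕ i + 0) % k   ≡⟨ cong (_% k) (ℕ.+-identityʳ (toℕ i)) ⟩
    toℕ i % k         ≡⟨ m<n⇒m%n≡m (Fin.toℕ<n i) ⟩
    toℕ i             ∎)
    where open ≡-Reasoning

  rotate-+ : ∀ i x y → rotate (rotate i x) y ≡ rotate i (x + y)
  rotate-+ i x y = Fin.toℕ-injective (begin
    toℕ (rotate (rotate i x) y)  ≡⟨ toℕ-rotate (rotate i x) y ⟩
    (toℕ (rotate i x) + y) % k   ≡⟨ cong (λ r → (r + y) % k) (toℕ-rotate i x) ⟩
    ((toℕ i + x) % k + y) % k    ≡⟨ cong (_% k) (ℕ.+-comm ((toℕ i + x) % k) y) ⟩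
    (y + (toℕ i + x) % k) % k    ≡⟨ [m+n%k]%k≡[m+n]%k y (toℕ i + x) ⟩
    (y + (toℕ i + x)) % k        ≡⟨ cong (_% k) (ℕ.+-comm y (toℕ i + x)) ⟩
    (toℕ i + x + y) % k          ≡⟨ cong (_% k) (ℕ.+-assoc (toℕ i) x y) ⟩
    (toℕ i + (x + y)) % k        ≡⟨ toℕ-rotate i (x + y) ⟨
    toℕ (rotate i (x + y))       ∎)
    where open ≡-Reasoning

  private
    -- `k ∸ toℕ i` is the negative of `toℕ i` modulo `k`. This gives both the left inverse behind
    -- `rotate-injective` and the witness in `rotate-surjective`.
    unrotate : ∀ (i : Fin k) x → (k ∸ toℕ i + (toℕ i + x)) % k ≡ x % k
    unrotate i x = begin
      (k ∸ toℕ i + (toℕ i + x)) % k  ≡⟨ cong (_% k) (ℕ.+-assoc (k ∸ toℕ i) (toℕ i) x) ⟨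
      (k ∸ toℕ i + toℕ i + x) % k    ≡⟨ cong (λ r → (r + x) % k) (ℕ.m∸n+n≡m (Fin.toℕ≤n i)) ⟩
      (k + x) % k                    ≡⟨ cong (_% k) (ℕ.+-comm k x) ⟩
      (x + k) % k                    ≡⟨ [m+n]%n≡m%n x k ⟩
      x % k                          ∎
      where open ≡-Reasoning

  rotate-injective : ∀ i {x y} → x < k → y < k → rotate i x ≡ rotate i y → x ≡ y
  rotate-injective i {x} {y} x<k y<k eq = begin
    x                                   ≡⟨ recover x<k ⟨
    (k ∸ toℕ i + toℕ (rotate i x)) % k  ≡⟨ cong (λ r → (k ∸ toℕ i + toℕ r) % k) eq ⟩
    (k ∸ toℕ i + toℕ (rotate i y)) % k  ≡⟨ recover y<k ⟩
    y                                   ∎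
    where
    open ≡-Reasoning
    recover : ∀ {x} → x < k → (k ∸ toℕ i + toℕ (rotate i x)) % k ≡ x
    recover {x} x<k = begin
      (k ∸ toℕ i + toℕ (rotate i x)) % k   ≡⟨ cong (λ r → (k ∸ toℕ i + r) % k) (toℕ-rotate i x) ⟩
      (k ∸ toℕ i + (toℕ i + x) % k) % k    ≡⟨ [m+n%k]%k≡[m+n]%k (k ∸ toℕ i) (toℕ i + x) ⟩
      (k ∸ toℕ i + (toℕ i + x)) % k        ≡⟨ unrotate i x ⟩
      x % k                                ≡⟨ m<n⇒m%n≡m x<k ⟩
      x                                    ∎

  rotate-surjective : ∀ i z → ∃[ x ] x < k × rotate i x ≡ z
  rotate-surjective i z = (k ∸ toℕ i + toℕ z) % k , m%n<n (k ∸ toℕ i + toℕ z) k ,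
    Fin.toℕ-injective (begin
      toℕ (rotate i ((k ∸ toℕ i + toℕ z) % k))  ≡⟨ toℕ-rotate i _ ⟩
      (toℕ i + (k ∸ toℕ i + toℕ z) % k) % k     ≡⟨ [m+n%k]%k≡[m+n]%k (toℕ i) (k ∸ toℕ i + toℕ z) ⟩
      (toℕ i + (k ∸ toℕ i + toℕ z)) % k         ≡⟨ cong (_% k) (x∙yz≈y∙xz (toℕ i) (k ∸ toℕ i) (toℕ z)) ⟩
      (k ∸ toℕ i + (toℕ i + toℕ z)) % k         ≡⟨ unrotate i (toℕ z) ⟩
      toℕ z % k                                 ≡⟨ m<n⇒m%n≡m (Fin.toℕ<n z) ⟩
      toℕ z                                     ∎)
    where
    open ≡-Reasoning

  rotate≢ : ∀ i {x} → 0 < x → x < k → i ≢ rotate i x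
  rotate≢ i 0<x x<k eq = ℕ.<⇒≢ 0<x
    (rotate-injective i (ℕ.<-trans 0<x x<k) x<k (trans (rotate-0 i) eq))

-- Colour offsets within a block

module _ (d : ℕ) where

  -- The offsets of 0, …, t are 0, 2, …, 2d followed by all numbers up to t + d:
  -- together with their successors they exhaust 0, …, t + d + 1.
  offset : ℕ → ℕ
  offset h = h + h ⊓ d

  offset-mono-< : ∀ {x y} → x < y → offset x < offset y
  offset-mono-< x<y = ℕ.+-mono-<-≤ x<y (ℕ.⊓-monoˡ-≤ d (ℕ.<⇒≤ x<y))

  offset-injective : ∀ {x y} → offset x ≡ offset y → x ≡ y
  offset-injective {x} {y} eq with ℕ.<-cmp x y
  ... | tri< x<y _ _ = contradiction eq (ℕ.<⇒≢ (offset-mono-< x<y))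
  ... | tri≈ _ x≡y _ = x≡y
  ... | tri> _ _ x>y = contradiction (sym eq) (ℕ.<⇒≢ (offset-mono-< x>y))

  offset-≤ : ∀ {t h} → h ≤ t → offset h ≤ t + d
  offset-≤ h≤t = ℕ.+-mono-≤ h≤t (ℕ.m⊓n≤n _ d)

  -- Induction on `m`: after an offset comes its successor, and after that successor one moves on to
  -- the next `h`.
  offset-covers : ∀ {t} → d ≤ t → ∀ m → m ≤ suc (t + d) →
                  ∃[ h ] h ≤ t × (m ≡ offset h ⊎ m ≡ suc (offset h))
  offset-covers d≤t zero m≤ = 0 , z≤n , inj₁ refl
  offset-covers {t} d≤t (suc m) m≤ with offset-covers d≤t m (ℕ.<⇒≤ m≤)
  ... | h , h≤t , inj₁ refl = h , h≤t , inj₂ refl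
  ... | h , h≤t , inj₂ refl with suc h ℕ.≤? d
  -- Below `d` offsets grow by 2, so the next number is itself an offset.
  ...   | yes h<d = suc h , ℕ.≤-trans h<d d≤t , inj₁ (cong suc (begin
    suc (h + h ⊓ d)    ≡⟨ cong (λ r → suc (h + r)) (ℕ.m≤n⇒m⊓n≡m (ℕ.<⇒≤ h<d)) ⟩
    suc (h + h)        ≡⟨ ℕ.+-suc h h ⟨
    h + suc h          ≡⟨ cong (h +_) (ℕ.m≤n⇒m⊓n≡m h<d) ⟨
    h + suc h ⊓ d      ∎))
    where open ≡-Reasoning
  -- From `d` on offsets grow by 1, so the next number is the successor of the next offset; the
  -- bound on `m` leaves room for it.
  ...   | no h≮d = suc h , h<t , inj₂ (cong (λ r → suc (suc (h + r)))
      (trans (ℕ.m≥n⇒m⊓n≡n d≤h) (sym (ℕ.m≥n⇒m⊓n≡n (ℕ.m≤n⇒m≤1+n d≤h)))))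
    where
    d≤h : d ≤ h
    d≤h = s≤s⁻¹ (ℕ.≰⇒> h≮d)
    h<t : h < t
    h<t = ℕ.+-cancelʳ-< d h t (subst (_< t + d) (cong (h +_) (ℕ.m≥n⇒m⊓n≡n d≤h)) (s≤s⁻¹ m≤))

-- The cycle and its edges

next : ∀ {n} (i : Fin n) → ∃[ j ] Next i j
next {suc n} i with suc (toℕ i) ℕ.<? suc n
... | yes p = fromℕ< p , inj₁ (Fin.toℕ-fromℕ< p)
... | no ¬p = zero , inj₂ (ℕ.≤-antisym (Fin.toℕ<n i) (ℕ.≮⇒≥ ¬p) , refl)

prev : ∀ {n} (j : Fin n) → ∃[ i ] Next i j
prev {suc n} zero    = fromℕ n , inj₂ (cong suc (Fin.toℕ-fromℕ n) , refl)
prev {suc n} (suc j) = inject₁ j , inj₁ (cong suc (sym (Fin.toℕ-inject₁ j)))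

next-unique : ∀ {n} {i j j′ : Fin n} → Next i j → Next i j′ → j ≡ j′
next-unique (inj₁ p)       (inj₁ q)       = Fin.toℕ-injective (trans p (sym q))
next-unique (inj₁ p)       (inj₂ (q , _)) = contradiction (trans p q) (ℕ.<⇒≢ (Fin.toℕ<n _))
next-unique (inj₂ (p , _)) (inj₁ q)       = contradiction (trans q p) (ℕ.<⇒≢ (Fin.toℕ<n _))
next-unique (inj₂ (_ , p)) (inj₂ (_ , q)) = Fin.toℕ-injective (trans p (sym q))

prev-unique : ∀ {n} {i i′ j : Fin n} → Next i j → Next i′ j → i ≡ i′
prev-unique (inj₁ p)       (inj₁ q)       =
  Fin.toℕ-injective (ℕ.suc-injective (trans (sym p) q))
prev-unique (inj₁ p)       (inj₂ (_ , q)) = contradiction (trans (sym q) p) (λ ())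
prev-unique (inj₂ (_ , p)) (inj₁ q)       = contradiction (trans (sym p) q) (λ ())
prev-unique (inj₂ (p , _)) (inj₂ (q , _)) =
  Fin.toℕ-injective (ℕ.suc-injective (trans p (sym q)))

-- Mutual succession would close the cycle after at most two steps. Taking `i` and `j` equal, this
-- also serves as irreflexivity.
next-asym : ∀ {n} {i j : Fin n} → 2 < n → Next i j → ¬ Next j i
next-asym 2<n (inj₁ p) (inj₁ q) =
  ℕ.<-asym (ℕ.≤-reflexive (sym p)) (ℕ.≤-reflexive (sym q))
next-asym 2<n (inj₁ p) (inj₂ (q , r)) =
  ℕ.<⇒≢ 2<n (trans (cong suc (sym (trans p (cong suc r)))) q)
next-asym 2<n (inj₂ (p , q)) (inj₁ r) =
  ℕ.<⇒≢ 2<n (trans (cong suc (sym (trans r (cong suc q)))) p)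
next-asym 2<n (inj₂ (p , q)) (inj₂ (r , s)) =
  ℕ.<⇒≢ (ℕ.<-trans (s<s z<s) 2<n) (trans (cong suc (sym q)) r)

-- Colours of the edge vertices

module _ {k n : ℕ} where

  -- Surplus edges get 0 so that the edge after the one of the last colour `k` has colour 0 both
  -- when the cycle closes there and when it goes on.
  wrap : Fin n → Fin (suc k)
  wrap i with toℕ i ℕ.<? suc k
  ... | yes i<k = fromℕ< i<k
  ... | no _    = zero

  toℕ-wrap : ∀ {i} → toℕ i < suc k → toℕ (wrap i) ≡ toℕ i
  toℕ-wrap {i} i<k with toℕ i ℕ.<? suc k
  ... | yes p = Fin.toℕ-fromℕ< p
  ... | no ¬p = contradiction i<k ¬p

  wrap-≥ : ∀ {i} → suc k ≤ toℕ i → wrap i ≡ zero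
  wrap-≥ {i} k≤i with toℕ i ℕ.<? suc k
  ... | yes p = contradiction k≤i (ℕ.<⇒≱ p)
  ... | no _  = refl

  wrap-0 : ∀ {i} → toℕ i ≡ 0 → wrap i ≡ zero
  wrap-0 i≡0 = Fin.toℕ-injective (trans (toℕ-wrap (subst (_< suc k) (sym i≡0) z<s)) i≡0)

  wrap-next-≥ : ∀ {i j} → Next i j → suc k ≤ suc (toℕ i) → wrap j ≡ zero
  wrap-next-≥ (inj₁ j≡1+i)     k≤1+i = wrap-≥ (ℕ.≤-trans k≤1+i (ℕ.≤-reflexive (sym j≡1+i)))
  wrap-next-≥ (inj₂ (_ , j≡0)) _     = wrap-0 j≡0

  wrap-next-< : ∀ {i j} → suc k ≤ n → Next i j → toℕ i < suc k → wrap j ≡ rotate (wrap i) 1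
  wrap-next-< {i} {j} k≤n p i<k = Fin.toℕ-injective (trans (step p) (sym (begin
    toℕ (rotate (wrap i) 1)     ≡⟨ toℕ-rotate (wrap i) 1 ⟩
    (toℕ (wrap i) + 1) % suc k  ≡⟨ cong (λ r → (r + 1) % suc k) (toℕ-wrap i<k) ⟩
    (toℕ i + 1) % suc k         ≡⟨ cong (_% suc k) (ℕ.+-comm (toℕ i) 1) ⟩
    suc (toℕ i) % suc k         ∎)))
    where
    open ≡-Reasoning
    step : Next i j → toℕ (wrap j) ≡ suc (toℕ i) % suc k
    step p with suc (toℕ i) ℕ.<? suc k
    -- Here `i` carries the last colour, and `suc (toℕ i)` is 0 modulo `suc k`.
    step p | no 1+i≮k = trans (cong toℕ (wrap-next-≥ p (ℕ.≮⇒≥ 1+i≮k)))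
      (sym (trans (cong (_% suc k) (ℕ.≤-antisym i<k (ℕ.≮⇒≥ 1+i≮k))) (n%n≡0 (suc k))))
    step (inj₁ j≡1+i) | yes 1+i<k = trans (toℕ-wrap (subst (_< suc k) (sym j≡1+i) 1+i<k))
      (trans j≡1+i (sym (m<n⇒m%n≡m 1+i<k)))
    -- As `suc k ≤ n`, the cycle cannot close before all colours have appeared.
    step (inj₂ (1+i≡n , _)) | yes 1+i<k =
      contradiction (subst (suc k ≤_) (sym 1+i≡n) k≤n) (ℕ.<⇒≱ 1+i<k)

  -- The second alternative comes from surplus edges, where both colours are 0; edge vertices are
  -- never adjacent to each other.
  wrap-next : ∀ {i j} → suc k ≤ n → Next i j →
              wrap j ≡ rotate (wrap i) 1 ⊎ wrap j ≡ wrap i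
  wrap-next {i} k≤n p with ℕ.<-≤-connex (toℕ i) (suc k)
  ... | inj₁ i<k = inj₁ (wrap-next-< k≤n p i<k)
  ... | inj₂ k≤i = inj₂ (trans (wrap-next-≥ p (ℕ.m≤n⇒m≤1+n k≤i)) (sym (wrap-≥ k≤i)))

-- The pairs ending at `j` = 0, 1, 2 suffice: 0 is missing from {1, 2}, 1 from {n - 1, 0} since n >
-- 2, and larger numbers from {0, 1}. As `z` stands for a colour, it may exceed all vertices.
prev-avoids : ∀ {n} → 2 < n → ∀ z → ∃[ j ] z ≢ toℕ (proj₁ (prev {n} j)) × z ≢ toℕ j
prev-avoids {suc (suc (suc n))} _ zero          = suc (suc zero) , (λ ()) , (λ ())
prev-avoids {suc (suc (suc n))} _ (suc zero)    = zero , (λ ()) , (λ ())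
prev-avoids {suc (suc (suc n))} _ (suc (suc z)) = suc zero , (λ ()) , (λ ())
prev-avoids {suc zero} (s≤s ())
prev-avoids {suc (suc zero)} (s≤s (s≤s ()))

-- Orienting the edges along the cycle

module _ {n} (2<n : 2 < n) where

  private cycle = C n 2<n
  open Graph cycle using (_IsEndOf_)

  -- An edge stores its ends in increasing order, so the closing edge is stored against the
  -- direction of the cycle; `Joins` forgets this order.
  Joins : Edge cycle → Fin n → Fin n → Set
  Joins f i j = value f ≡ (i , j) ⊎ value f ≡ (j , i)

  connect : ∀ {i j} → Next i j → ∃[ f ] Joins f i j
  connect {i} {j} p with Fin.<-cmp i j
  ... | tri< i<j _ _ = ((i , j) , [ i<j , inj₁ p ]) , inj₁ refl
  ... | tri> _ _ i>j = ((j , i) , [ i>j , inj₂ p ]) , inj₂ refl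
  ... | tri≈ _ refl _ = contradiction p (next-asym 2<n p)

  abstract
    -- The adjacency proof in an edge is irrelevant and is recovered by deciding adjacency.
    orient : (f : Edge cycle) → ∃[ i ] ∃[ j ] Next i j × Joins f i j
    orient ((i , j) , [ p ]) with recompute (Graph.adj? cycle i j) (proj₂ p)
    ... | inj₁ q = i , j , q , inj₁ refl
    ... | inj₂ q = j , i , q , inj₂ refl

  -- `tail` is a bijection from edges to vertices, with inverse `edge`; it supplies the index i of
  -- e_i.
  tail head : Edge cycle → Fin n
  tail = proj₁ ∘ orient
  head = proj₁ ∘ proj₂ ∘ orient

  next-tail : ∀ f → Next (tail f) (head f)
  next-tail f = proj₁ (proj₂ (proj₂ (orient f)))

  joins-tail : ∀ f → Joins f (tail f) (head f)
  joins-tail f = proj₂ (proj₂ (proj₂ (orient f)))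

  -- Opposite storage orders would give both `i < j` and `j < i`; otherwise the edges differ only in
  -- irrelevant proofs.
  joins⇒≡ : ∀ {f g i j} → Joins f i j → Joins g i j → f ≡ g
  joins⇒≡ (inj₁ refl) (inj₁ refl) = refl
  joins⇒≡ {(i , j) , [ p ]} {_ , [ q ]} (inj₁ refl) (inj₂ refl) =
    contradiction (recompute (i Fin.<? j) (proj₁ p))
      (Fin.<-asym (recompute (j Fin.<? i) (proj₁ q)))
  joins⇒≡ {(i , j) , [ p ]} {_ , [ q ]} (inj₂ refl) (inj₁ refl) =
    contradiction (recompute (i Fin.<? j) (proj₁ p))
      (Fin.<-asym (recompute (j Fin.<? i) (proj₁ q)))
  joins⇒≡ (inj₂ refl) (inj₂ refl) = refl

  tail-injective : ∀ {f g} → tail f ≡ tail g → f ≡ g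
  tail-injective {f} {g} eq = joins⇒≡ (joins-tail f)
    (subst (Joins g (tail f))
      (next-unique (next-tail g) (subst (λ i → Next i (head f)) eq (next-tail f)))
      (subst (λ i → Joins g i (head g)) (sym eq) (joins-tail g)))

  end⇒ : ∀ {f i j u} → Joins f i j → u IsEndOf f → u ≡ i ⊎ u ≡ j
  end⇒ (inj₁ refl) p = p
  end⇒ (inj₂ refl) p = swap p

  ends : ∀ {f u} → u IsEndOf f → u ≡ tail f ⊎ u ≡ head f
  ends {f} = end⇒ {f} {tail f} {head f} (joins-tail f)

  joins⇒ends : ∀ {f i j} → Joins f i j → i IsEndOf f × j IsEndOf f
  joins⇒ends (inj₁ refl) = inj₁ refl , inj₂ refl
  joins⇒ends (inj₂ refl) = inj₂ refl , inj₁ refl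

  edge : Fin n → Edge cycle
  edge i = proj₁ (connect (proj₂ (next i)))

  joins-edge : ∀ {i j} → Next i j → Joins (edge i) i j
  joins-edge {i} p =
    subst (Joins (edge i) i) (next-unique (proj₂ (next i)) p) (proj₂ (connect (proj₂ (next i))))

  edge-tail : ∀ f → edge (tail f) ≡ f
  edge-tail f = joins⇒≡ (joins-edge (next-tail f)) (joins-tail f)

  -- Were `i` the head, the tail would be its successor, against `next-asym`, or the successor would
  -- be `i` itself.
  tail-edge : ∀ i → tail (edge i) ≡ i
  tail-edge i with next i
  ... | j , p with connect p
  ... | f , q with ends {f} (proj₁ (joins⇒ends {f} {i} {j} q)) | ends {f} (proj₂ (joins⇒ends {f} {i} {j} q))
  ... | inj₁ r    | _         = sym r
  ... | inj₂ refl | inj₁ refl = contradiction (next-tail f) (next-asym 2<n p)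
  ... | inj₂ refl | inj₂ refl = contradiction p (next-asym 2<n p)

  pred : Fin n → Fin n
  pred u = proj₁ (prev u)

  -- The vertex is either the tail of `f`, which determines `f`, or its head, and then the tail is
  -- the predecessor.
  incident : ∀ {f u} → u IsEndOf f → f ≡ edge u ⊎ f ≡ edge (pred u)
  incident {f} {u} p with ends {f} p
  ... | inj₁ refl = inj₁ (sym (edge-tail f))
  ... | inj₂ refl = inj₂ (trans (sym (edge-tail f))
    (cong edge (prev-unique (next-tail f) (proj₂ (prev u)))))

  -- Closed neighbourhoods in the corona and the upper bound

  module _ (t : ℕ) where

    private G = cycle ⊡ K t

    -- u_i and the vertices of its copy of K_t have the same neighbours among
    -- the edge vertices, so they are treated together.
    block : Fin n → Fin (suc t) → Vertex G
    block u zero    = inj₁ (inj₁ u)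
    block u (suc h) = inj₂ (u , h)

    edgeVertex : Edge cycle → Vertex G
    edgeVertex f = inj₁ (inj₂ f)

    edge~block : ∀ {f u} h → u IsEndOf f → Adj G (edgeVertex f) (block u h)
    edge~block zero    p = p
    edge~block (suc h) p = p

    private
      incident-∈ : ∀ {f u xs} → u IsEndOf f →
                   edgeVertex f ∈ edgeVertex (edge u) ∷ edgeVertex (edge (pred u)) ∷ xs
      incident-∈ {f} p with incident {f = f} p
      ... | inj₁ eq = here (cong edgeVertex eq)
      ... | inj₂ eq = there (here (cong edgeVertex eq))

      blocks : Edge cycle → List (Vertex G)
      blocks f = map (block (tail f)) (allFin (suc t)) ++ map (block (head f)) (allFin (suc t))

      length-blocks : ∀ f → length (blocks f) ≡ suc t + suc t
      length-blocks f = trans (length-++ (map (block (tail f)) (allFin (suc t))))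
        (cong₂ _+_ (length-block (tail f)) (length-block (head f)))
        where
        length-block : ∀ u → length (map (block u) (allFin (suc t))) ≡ suc t
        length-block u = trans (length-map (block u) (allFin (suc t))) (length-tabulate {n = suc t} (λ h → h))

      block-∈ : ∀ {f u} h → u IsEndOf f → block u h ∈ blocks f
      block-∈ {f} h p with ends {f = f} p
      ... | inj₁ eq = subst (λ u → block u h ∈ blocks f) (sym eq)
        (∈-++⁺ˡ (∈-map⁺ (block (tail f)) (∈-allFin h)))
      ... | inj₂ eq = subst (λ u → block u h ∈ blocks f) (sym eq)
        (∈-++⁺ʳ (map (block (tail f)) (allFin (suc t))) (∈-map⁺ (block (head f)) (∈-allFin h)))

    module _ {m} {c : Vertex G → Fin m} where

      cycle-bVertex : ∀ u → IsBVertex G c (inj₁ (inj₁ u)) → m ≤ 3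
      cycle-bVertex u = bVertex⇒≤ G
        (edgeVertex (edge u) ∷ edgeVertex (edge (pred u)) ∷ inj₁ (inj₁ u) ∷ [])
        (there (there (here refl)))
        λ { (inj₁ (inj₂ f)) p → incident-∈ {f} p }

      copy-bVertex : ∀ u h → IsBVertex G c (inj₂ (u , h)) → m ≤ 2 + t
      copy-bVertex u h b = subst (m ≤_) (cong (2 +_) length-copy)
        -- The b-vertex itself is counted within `copy`, hence `2 + t`.
        (bVertex⇒≤ G (edgeVertex (edge u) ∷ edgeVertex (edge (pred u)) ∷ copy)
          (copy-∈ h)
          (λ { (inj₁ (inj₂ f)) p → incident-∈ {f} p ; (inj₂ (_ , k)) (refl , _) → copy-∈ k })
          b)
        where
        copy : List (Vertex G)
        copy = map (λ k → inj₂ (u , k)) (allFin t)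

        copy-∈ : ∀ {x y} k → inj₂ (u , k) ∈ x ∷ y ∷ copy
        copy-∈ k = there (there (∈-map⁺ _ (∈-allFin k)))

        length-copy : length copy ≡ t
        length-copy = trans (length-map _ (allFin t)) (length-tabulate {n = t} (λ h → h))

      edge-bVertex : ∀ f → IsBVertex G c (edgeVertex f) → m ≤ 3 + t + t
      edge-bVertex f b = subst (m ≤_) (cong suc (trans (length-blocks f) (cong suc (ℕ.+-suc t t))))
        (bVertex⇒≤ G (edgeVertex f ∷ blocks f) (here refl)
          (λ { (inj₁ (inj₁ u)) p → there (block-∈ {f} zero p)
             ; (inj₂ (u , h)) p → there (block-∈ {f} (suc h) p) })
          b)

    -- In the second alternative the b-vertices of distinct colours are distinct edge vertices, so
    -- `tail` injects the colours into the cycle. The neighbourhood bound is then read off at colour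
    -- 0.
    upperBound : ∀ {m} → 0 < t → BColourable G m → m ≤ 2 + t ⊎ (m ≤ n × m ≤ 3 + t + t)
    upperBound {m} 0<t (c , _ , bs) with m ℕ.≤? 2 + t
    ... | yes m≤2+t = inj₁ m≤2+t
    ... | no m≰2+t = inj₂ (Fin.injective⇒≤ {f = tail ∘ proj₁ ∘ edgeOf} injective ,
        edge-bVertex _ (proj₂ (proj₂ (edgeOf (fromℕ< (ℕ.≤-<-trans z≤n (ℕ.≰⇒> m≰2+t)))))))
      where
      edgeOf : ∀ i → ∃[ f ] c (edgeVertex f) ≡ i × IsBVertex G c (edgeVertex f)
      edgeOf i with bs i
      -- Positivity of `t` turns the bound 3 into `2 + t`.
      ... | inj₁ (inj₁ u) , _ , b =
        contradiction (ℕ.≤-trans (cycle-bVertex u b) (s≤s (s≤s 0<t))) m≰2+t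
      ... | inj₁ (inj₂ f) , eq , b = f , eq , b
      ... | inj₂ (u , h) , _ , b = contradiction (copy-bVertex u h b) m≰2+t

      injective : ∀ {i j} → tail (proj₁ (edgeOf i)) ≡ tail (proj₁ (edgeOf j)) → i ≡ j
      injective {i} {j} eq = trans (sym (proj₁ (proj₂ (edgeOf i))))
        (trans (cong (c ∘ edgeVertex) (tail-injective eq)) (proj₁ (proj₂ (edgeOf j))))

    -- Colourings attaining the bound

    module _ {k} (e : Fin n → Fin k) (b : Fin n → Fin (suc t) → Fin k) where

      colouring : Vertex G → Fin k
      colouring (inj₁ (inj₁ u)) = b u zero
      colouring (inj₁ (inj₂ f)) = e (tail f)
      colouring (inj₂ (u , h))  = b u (suc h)

      colouring-block : ∀ u h → colouring (block u h) ≡ b u h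
      colouring-block u zero    = refl
      colouring-block u (suc h) = refl

      colouring-edge : ∀ i → colouring (edgeVertex (edge i)) ≡ e i
      colouring-edge i = cong e (tail-edge i)

      edge-isBVertex : ∀ {i j} → Next i j →
                       (∀ z → z ≢ e i → ∃[ h ] (b i h ≡ z ⊎ b j h ≡ z)) →
                       IsBVertex G colouring (edgeVertex (edge i))
      edge-isBVertex {i} {j} p covers z z≢
        with covers z (z≢ ∘ λ eq → trans eq (sym (colouring-edge i)))
      ... | h , inj₁ eq = block i h ,
        edge~block {edge i} h (proj₁ (joins⇒ends {edge i} (joins-edge p))) ,
        trans (colouring-block i h) eq
      ... | h , inj₂ eq = block j h ,
        edge~block {edge i} h (proj₂ (joins⇒ends {edge i} (joins-edge p))) ,
        trans (colouring-block j h) eq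

      -- The two edge vertices at `j` show `e i` and `e j`; the copy must show the rest. Index 0 of
      -- the block is excluded because the cycle vertex is not adjacent to its copy.
      copy-isBVertex : ∀ {i j} → Next i j →
                       (∀ z → z ≢ e i → z ≢ e j → ∃[ h ] b j (suc h) ≡ z) →
                       ∀ h → IsBVertex G colouring (inj₂ (j , h))
      copy-isBVertex {i} {j} p covers h z z≢ with z Fin.≟ e i | z Fin.≟ e j
      ... | yes z≡ei | _ = edgeVertex (edge i) ,
        proj₂ (joins⇒ends {edge i} (joins-edge p)) ,
        trans (colouring-edge i) (sym z≡ei)
      ... | no _ | yes z≡ej = edgeVertex (edge j) ,
        proj₁ (joins⇒ends {edge j} (joins-edge (proj₂ (next j)))) ,
        trans (colouring-edge j) (sym z≡ej)
      ... | no z≢ei | no z≢ej with h′ , eq ← covers z z≢ei z≢ej =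
        inj₂ (j , h′) , (refl , λ { refl → z≢ (sym eq) }) , eq

      colouring-proper : (∀ {i} h → e i ≢ b i h) → (∀ {i j} → Next i j → ∀ h → e i ≢ b j h) →
                         (∀ j {h h′} → b j (suc h) ≡ b j (suc h′) → h ≡ h′) →
                         Proper G colouring
      colouring-proper avoids avoids-next injective = proper
        where
        avoids-end : ∀ {f u} h → u IsEndOf f → e (tail f) ≢ b u h
        avoids-end {f} h p eq with ends {f} p
        ... | inj₁ q = avoids h (trans eq (cong (λ u → b u h) q))
        ... | inj₂ q = avoids-next (next-tail f) h (trans eq (cong (λ u → b u h) q))

        proper : Proper G colouring
        proper (inj₁ (inj₁ u)) (inj₁ (inj₂ f)) p = ≢-sym (avoids-end {f} zero p)
        proper (inj₁ (inj₂ f)) (inj₁ (inj₁ u)) p = avoids-end {f} zero p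
        proper (inj₁ (inj₂ f)) (inj₂ (u , h))  p = avoids-end {f} (suc h) p
        proper (inj₂ (u , h))  (inj₁ (inj₂ f)) p = ≢-sym (avoids-end {f} (suc h) p)
        proper (inj₂ (u , h))  (inj₂ (_ , h′)) (refl , h≢h′) = h≢h′ ∘ injective u

    -- The range includes n = t + 2, where the count of colours equals n; the middle case of the
    -- theorem relies on this.
    smallColouring : 0 < t → n ≤ 2 + t → BColourable G (2 + t)
    smallColouring 0<t n≤k = colouring e b ,
      colouring-proper e b
        (λ {i} h → ≢-sym (except≢ʳ (e-prev i) (collapse h)))
        (λ { {i} {j} p h eq → except≢ˡ (e-prev j) (collapse h)
             (trans (sym eq) (cong e (prev-unique p (proj₂ (prev j))))) })
        (λ j → except-injective (e-prev j)) ,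
      bVertices
      where
      e : Fin n → Fin (2 + t)
      e i = inject≤ i n≤k

      e-prev : ∀ j → e (pred j) ≢ e j
      e-prev j eq with prev j
      ... | i , p with refl ← Fin.inject≤-injective n≤k n≤k i j eq = next-asym 2<n p p

      -- u_j is not adjacent to its copy of K_t, so it may repeat a colour of it.
      collapse : Fin (suc t) → Fin t
      collapse zero    = fromℕ< 0<t
      collapse (suc h) = h

      b : Fin n → Fin (suc t) → Fin (2 + t)
      b j h = except (e-prev j) (collapse h)

      bVertices : ∀ z → ∃[ v ] colouring e b v ≡ z × IsBVertex G (colouring e b) v
      -- At this `j` neither edge vertex has colour `z`, so `z` occurs in the copy.
      bVertices z with prev-avoids 2<n (toℕ z)
      ... | j , z≢i , z≢j
        with h , eq ← except-surjective (e-prev j) {z}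
               (λ eq → z≢i (trans (cong toℕ eq) (Fin.toℕ-inject≤ _ n≤k)))
               (λ eq → z≢j (trans (cong toℕ eq) (Fin.toℕ-inject≤ _ n≤k)))
        = inj₂ (j , h) , eq ,
          copy-isBVertex e b (proj₂ (prev j)) (λ _ → except-surjective (e-prev j)) h

    largeColouring : ∀ {d} → d ≤ t → 3 + t + d ≤ n → BColourable G (3 + t + d)
    largeColouring {d} d≤t k≤n = colouring e b ,
      colouring-proper e b
        (λ {i} h → rotate≢ (e i) z<s (ℕ.<⇒≤ (offset-< h)))
        avoids-next
        (λ j {h} {h′} eq → Fin.suc-injective (Fin.toℕ-injective (offset-injective d (ℕ.suc-injective
          (rotate-injective (e j) (ℕ.<⇒≤ (offset-< (suc h))) (ℕ.<⇒≤ (offset-< (suc h′))) eq))))) ,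
      bVertices
      where
      k : ℕ
      k = 3 + t + d

      e : Fin n → Fin k
      e = wrap

      b : Fin n → Fin (suc t) → Fin k
      b j h = rotate (e j) (suc (offset d (toℕ h)))

      -- Seen from the preceding edge vertex a block is shifted by `2 + offset`, which must not come
      -- round to 0 modulo `k`; this is tight for `h` = t. Seen from its own edge vertex the shift
      -- is one less.
      offset-< : ∀ (h : Fin (suc t)) → 2 + offset d (toℕ h) < k
      offset-< h = s≤s (s≤s (s≤s (offset-≤ d (Fin.toℕ≤pred[n] h))))

      b-next : ∀ {i j} h → e j ≡ rotate (e i) 1 →
               b j h ≡ rotate (e i) (2 + offset d (toℕ h))
      b-next {i} h eq = trans (cong (λ c → rotate c _) eq) (rotate-+ (e i) 1 _)

      avoids-next : ∀ {i j} → Next i j → ∀ h → e i ≢ b j h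
      avoids-next {i} {j} p h eq with wrap-next k≤n p
      ... | inj₁ q = rotate≢ (e i) z<s (offset-< h) (trans eq (b-next {i} {j} h q))
      -- Both edges have colour 0, so the shift is that from the block's own edge.
      ... | inj₂ q = rotate≢ (e i) z<s (ℕ.<⇒≤ (offset-< h)) (trans eq (cong (λ c → rotate c _) q))

      covers : ∀ {i j} → e j ≡ rotate (e i) 1 → ∀ z → z ≢ e i → ∃[ h ] (b i h ≡ z ⊎ b j h ≡ z)
      covers {i} {j} q z z≢ei with rotate-surjective (e i) z
      ... | zero , _ , eq = contradiction (trans (sym eq) (rotate-0 (e i))) z≢ei
      -- Nonzero shifts from `e i` are `suc m` with m ≤ t + d + 1. The block at `i` shows those
      -- where `m` is an offset, the block at `j` those where it is the successor of one.
      ... | suc m , m<k , eq with offset-covers d d≤t m (s≤s⁻¹ (s≤s⁻¹ m<k))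
      ...   | h , h≤t , inj₁ refl = fromℕ< (s≤s h≤t) ,
        inj₁ (trans (cong (λ x → rotate (e i) (suc (offset d x))) (Fin.toℕ-fromℕ< (s≤s h≤t))) eq)
      ...   | h , h≤t , inj₂ refl = fromℕ< (s≤s h≤t) ,
        inj₂ (trans (b-next {i} {j} (fromℕ< (s≤s h≤t)) q)
          (trans (cong (λ x → rotate (e i) (2 + offset d x)) (Fin.toℕ-fromℕ< (s≤s h≤t))) eq))

      bVertices : ∀ z → ∃[ v ] colouring e b v ≡ z × IsBVertex G (colouring e b) v
      bVertices z = edgeVertex (edge i) , trans (colouring-edge e b i) e-i ,
        edge-isBVertex e b p (covers {i} {proj₁ (next i)} (wrap-next-< k≤n p i<k))
        where
        i : Fin n
        i = inject≤ z k≤n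

        p : Next i (proj₁ (next i))
        p = proj₂ (next i)

        i<k : toℕ i < k
        i<k = subst (_< k) (sym (Fin.toℕ-inject≤ z k≤n)) (Fin.toℕ<n z)

        e-i : e i ≡ z
        e-i = Fin.toℕ-injective (trans (toℕ-wrap i<k) (Fin.toℕ-inject≤ z k≤n))

-- Choice of the colouring in each range of n

theorem14 : (n t : ℕ) (2<n : 2 < n) → 0 < t →
    φ (C n 2<n ⊡ K t) ≐
    (if n ≤ᵇ t + 1 then t + 2
    else if (t + 2 ≤ᵇ n) ∧ (n ≤ᵇ 2 * t + 3) then n
    else 2 * t + 3)
theorem14 n t 2<n 0<t
  -- `2 * t` unfolds to `t + (t + 0)`; everything is brought to the form of the bounds above.
  rewrite ℕ.+-comm t 1 | ℕ.+-comm t 2 | ℕ.+-comm (2 * t) 3 | ℕ.+-identityʳ t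
  with n ≤ᵇ 1 + t | ℕ.≤ᵇ-reflects-≤ n (1 + t)
... | true | ofʸ n≤1+t = smallColouring 2<n t 0<t (ℕ.m≤n⇒m≤1+n n≤1+t) , λ m col →
  [ (λ m≤2+t → m≤2+t) , (λ (m≤n , _) → ℕ.≤-trans m≤n (ℕ.m≤n⇒m≤1+n n≤1+t)) ]′
    (upperBound 2<n t 0<t col)
... | false | ofⁿ n≰1+t
  with 2 + t ≤ᵇ n | ℕ.≤ᵇ-reflects-≤ (2 + t) n | n ≤ᵇ 3 + (t + t) | ℕ.≤ᵇ-reflects-≤ n (3 + (t + t))
... | false | ofⁿ 2+t≰n | _     | _ = contradiction (ℕ.≰⇒> n≰1+t) 2+t≰n
... | true  | ofʸ 2+t≤n | true  | ofʸ n≤3+2t = colourable , λ m col →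
  [ (λ m≤2+t → ℕ.≤-trans m≤2+t 2+t≤n) , proj₁ ]′ (upperBound 2<n t 0<t col)
  where
  colourable : BColourable (C n 2<n ⊡ K t) n
  colourable with n ℕ.≤? 2 + t
  ... | yes n≤2+t = subst (BColourable (C n 2<n ⊡ K t)) (ℕ.≤-antisym 2+t≤n n≤2+t)
    (smallColouring 2<n t 0<t n≤2+t)
  -- Here d = n - t - 3, and n ≤ 2t + 3 becomes d ≤ t.
  ... | no n≰2+t with d , refl ← ℕ.m≤n⇒∃[o]m+o≡n (ℕ.≰⇒> n≰2+t) =
    largeColouring 2<n t (ℕ.+-cancelˡ-≤ (3 + t) d t n≤3+2t) ℕ.≤-refl
... | true  | ofʸ 2+t≤n | false | ofⁿ n≰3+2t =
  -- The extreme choice d = t gives 2t + 3 colours.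
  largeColouring 2<n t ℕ.≤-refl (ℕ.<⇒≤ (ℕ.≰⇒> n≰3+2t)) , λ m col →
  [ (λ m≤2+t → ℕ.≤-trans m≤2+t (s≤s (s≤s (ℕ.m≤n⇒m≤1+n (ℕ.m≤m+n t t))))) , proj₂ ]′
    (upperBound 2<n t 0<t col)
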